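{- For every sequent $\Gamma \Rightarrow \Delta$ of first-order arithmetic: if $\mathrm{CPA} \vdash \Gamma \Rightarrow \Delta$ then $\mathrm{PA} \vdash \Gamma \Rightarrow \Delta$.
   Context: Language of first-order arithmetic: terms from variables, $0,S,+,\cdot$; formulas from $s=t,\bot,\wedge,\vee,\to,\forall,\exists$. Sequents $\Gamma\Rightarrow\Delta$ consist of finite sets $\Gamma,\Delta$ of formulas. $\mathrm{PA}$ is the classical (multi-conclusion) sequent calculus with the standard classical rules for first-order logic with equality, weakening and cut, the arithmetic axioms $\Rightarrow 0\neq St$, $Ss=St\Rightarrow s=t$, $\Rightarrow s+0=s$, $\Rightarrow s+St=S(s+t)$, $\Rightarrow s\cdot 0=0$, $\Rightarrow s\cdot St=(s\cdot t)+s$, and the induction axioms $\varphi(0),\forall x.\,\varphi(x)\to\varphi(Sx)\Rightarrow\varphi(s)$; proofs are finite trees. $\mathrm{CPA}$ (cyclic Peano arithmetic) has the rules of $\mathrm{PA}$ without induction axioms, plus $\textsc{Case}_x$: from $\Gamma[0/x]\Rightarrow\Delta[0/x]$ and $\Gamma[Sx/x]\Rightarrow\Delta[Sx/x]$ infer $\Gamma\Rightarrow\Delta$. A pre-proof is a finite tree with a partial map $\beta$ sending some leaves (buds) to inner nodes (companions), all non-bud nodes labelled by rule instances whose premises label the children, and each bud labelled by the sequent of its companion. An infinite branch starts at the root and each next node is a child of the current node or, for a bud, its companion. A variable $x$ has a progressing trace along an infinite branch if from some point on $x$ is free in every sequent of the branch and the branch passes instances of $\textsc{Case}_x$ infinitely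 often. A $\mathrm{CPA}$-proof is a pre-proof in which every infinite branch has a variable with a progressing trace. -}

module Defs where

open import Data.Nat using (ℕ; zero; suc; _≤_; _<_; _≡ᵇ_)
open import Data.Fin using (Fin) renaming (zero to fz; suc to fs)
open import Data.Bool using (if_then_else_)
open import Data.List using (List; []; _∷_; [_]; map; length; _∷ʳ_)
open import Data.Maybe using (Maybe; just; nothing)
open import Data.Product using (Σ; _×_; _,_)
open import Data.Sum using (_⊎_)
open import Data.Empty using (⊥)
open import Relation.Nullary using (¬_)
open import Relation.Binary.PropositionalEquality using (_≡_)
open import Data.List.Relation.Unary.All using (All)
open import Data.List.Relation.Unary.Any using (Any)
open import Data.List.Relation.Binary.Pointwise using (Pointwise)
open import Data.List.Membership.Propositional using (_∈_)

-- Syntax (locally nameless): free variables are named by ℕ,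
-- bound variables are de Bruijn indices Fin n (n = number of binders in scope).

data Term (n : ℕ) : Set where
  fv   : ℕ → Term n
  bv   : Fin n → Term n
  `0   : Term n
  `S   : Term n → Term n
  _`+_ : Term n → Term n → Term n
  _`·_ : Term n → Term n → Term n

infix  9 _`=_
infixr 8 _`∧_ _`∨_
infixr 7 _`→_

data Formula (n : ℕ) : Set where
  _`=_ : Term n → Term n → Formula n
  `⊥   : Formula n
  _`∧_ : Formula n → Formula n → Formula n
  _`∨_ : Formula n → Formula n → Formula n
  _`→_ : Formula n → Formula n → Formula n
  `∀   : Formula (suc n) → Formula n
  `∃   : Formula (suc n) → Formula n

`¬ : ∀ {n} → Formula n → Formula n
`¬ φ = φ `→ `⊥

renT : ∀ {m k} → (Fin m → Fin k) → Term m → Term k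
renT ρ (fv x)   = fv x
renT ρ (bv i)   = bv (ρ i)
renT ρ `0       = `0
renT ρ (`S t)   = `S (renT ρ t)
renT ρ (s `+ t) = renT ρ s `+ renT ρ t
renT ρ (s `· t) = renT ρ s `· renT ρ t

substT : ∀ {m k} → (Fin m → Term k) → Term m → Term k
substT σ (fv x)   = fv x
substT σ (bv i)   = σ i
substT σ `0       = `0
substT σ (`S t)   = `S (substT σ t)
substT σ (s `+ t) = substT σ s `+ substT σ t
substT σ (s `· t) = substT σ s `· substT σ t

lift : ∀ {m k} → (Fin m → Term k) → Fin (suc m) → Term (suc k)
lift σ fz     = bv fz
lift σ (fs i) = renT fs (σ i)

substF : ∀ {m k} → (Fin m → Term k) → Formula m → Formula k
substF σ (s `= t) = substT σ s `= substT σ t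
substF σ `⊥       = `⊥
substF σ (φ `∧ ψ) = substF σ φ `∧ substF σ ψ
substF σ (φ `∨ ψ) = substF σ φ `∨ substF σ ψ
substF σ (φ `→ ψ) = substF σ φ `→ substF σ ψ
substF σ (`∀ φ)   = `∀ (substF (lift σ) φ)
substF σ (`∃ φ)   = `∃ (substF (lift σ) φ)

inst : ∀ {n} → Formula (suc n) → Term n → Formula n
inst {n} φ t = substF σ φ
  where
  σ : Fin (suc n) → Term n
  σ fz     = t
  σ (fs i) = bv i

emb : ∀ {n} → Term 0 → Term n
emb = substT (λ ())

fsubT : ∀ {n} → ℕ → Term 0 → Term n → Term n
fsubT x t (fv y)   = if x ≡ᵇ y then emb t else fv y
fsubT x t (bv i)   = bv i
fsubT x t `0       = `0
fsubT x t (`S u)   = `S (fsubT x t u)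
fsubT x t (u `+ v) = fsubT x t u `+ fsubT x t v
fsubT x t (u `· v) = fsubT x t u `· fsubT x t v

fsubF : ∀ {n} → ℕ → Term 0 → Formula n → Formula n
fsubF x t (u `= v) = fsubT x t u `= fsubT x t v
fsubF x t `⊥       = `⊥
fsubF x t (φ `∧ ψ) = fsubF x t φ `∧ fsubF x t ψ
fsubF x t (φ `∨ ψ) = fsubF x t φ `∨ fsubF x t ψ
fsubF x t (φ `→ ψ) = fsubF x t φ `→ fsubF x t ψ
fsubF x t (`∀ φ)   = `∀ (fsubF x t φ)
fsubF x t (`∃ φ)   = `∃ (fsubF x t φ)

FreeT : ∀ {n} → ℕ → Term n → Set
FreeT x (fv y)   = x ≡ y
FreeT x (bv i)   = ⊥
FreeT x `0       = ⊥
FreeT x (`S t)   = FreeT x t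
FreeT x (s `+ t) = FreeT x s ⊎ FreeT x t
FreeT x (s `· t) = FreeT x s ⊎ FreeT x t

FreeF : ∀ {n} → ℕ → Formula n → Set
FreeF x (s `= t) = FreeT x s ⊎ FreeT x t
FreeF x `⊥       = ⊥
FreeF x (φ `∧ ψ) = FreeF x φ ⊎ FreeF x ψ
FreeF x (φ `∨ ψ) = FreeF x φ ⊎ FreeF x ψ
FreeF x (φ `→ ψ) = FreeF x φ ⊎ FreeF x ψ
FreeF x (`∀ φ)   = FreeF x φ
FreeF x (`∃ φ)   = FreeF x φ

-- Sequents. A sequent is a pair of lists of (closed-under-binders) formulas,
-- read as finite sets: the structural rule `str` identifies lists with the
-- same elements.

Fml : Set
Fml = Formula 0

infix 3 _⇒_
record Sequent : Set where
  constructor _⇒_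
  field
    ant : List Fml
    succ : List Fml

FreeS : ℕ → Sequent → Set
FreeS x (Γ ⇒ Δ) = Any (FreeF x) Γ ⊎ Any (FreeF x) Δ

_≋_ : List Fml → List Fml → Set
Γ ≋ Γ' = ∀ φ → (φ ∈ Γ → φ ∈ Γ') × (φ ∈ Γ' → φ ∈ Γ)

subS : ℕ → Term 0 → Sequent → Sequent
subS x t (Γ ⇒ Δ) = map (fsubF x t) Γ ⇒ map (fsubF x t) Δ

data Rule : Sequent → List Sequent → Set where
  ax    : ∀ φ → Rule ([ φ ] ⇒ [ φ ]) []
  ⊥L    : Rule ([ `⊥ ] ⇒ []) []
  str   : ∀ {Γ Δ Γ' Δ'} → Γ ≋ Γ' → Δ ≋ Δ' → Rule (Γ ⇒ Δ) [ Γ' ⇒ Δ' ]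
  wkL   : ∀ {Γ Δ} φ → Rule (φ ∷ Γ ⇒ Δ) [ Γ ⇒ Δ ]
  wkR   : ∀ {Γ Δ} φ → Rule (Γ ⇒ φ ∷ Δ) [ Γ ⇒ Δ ]
  cut   : ∀ {Γ Δ} φ → Rule (Γ ⇒ Δ) ((Γ ⇒ φ ∷ Δ) ∷ (φ ∷ Γ ⇒ Δ) ∷ [])
  ∧L    : ∀ {Γ Δ} φ ψ → Rule (φ `∧ ψ ∷ Γ ⇒ Δ) [ φ ∷ ψ ∷ Γ ⇒ Δ ]
  ∧R    : ∀ {Γ Δ} φ ψ → Rule (Γ ⇒ φ `∧ ψ ∷ Δ) ((Γ ⇒ φ ∷ Δ) ∷ (Γ ⇒ ψ ∷ Δ) ∷ [])
  ∨L    : ∀ {Γ Δ} φ ψ → Rule (φ `∨ ψ ∷ Γ ⇒ Δ) ((φ ∷ Γ ⇒ Δ) ∷ (ψ ∷ Γ ⇒ Δ) ∷ [])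
  ∨R    : ∀ {Γ Δ} φ ψ → Rule (Γ ⇒ φ `∨ ψ ∷ Δ) [ Γ ⇒ φ ∷ ψ ∷ Δ ]
  →L    : ∀ {Γ Δ} φ ψ → Rule (φ `→ ψ ∷ Γ ⇒ Δ) ((Γ ⇒ φ ∷ Δ) ∷ (ψ ∷ Γ ⇒ Δ) ∷ [])
  →R    : ∀ {Γ Δ} φ ψ → Rule (Γ ⇒ φ `→ ψ ∷ Δ) [ φ ∷ Γ ⇒ ψ ∷ Δ ]
  ∀L    : ∀ {Γ Δ} φ (t : Term 0) → Rule (`∀ φ ∷ Γ ⇒ Δ) [ inst φ t ∷ Γ ⇒ Δ ]
  ∀R    : ∀ {Γ Δ} φ y → ¬ FreeS y (Γ ⇒ `∀ φ ∷ Δ) →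
          Rule (Γ ⇒ `∀ φ ∷ Δ) [ Γ ⇒ inst φ (fv y) ∷ Δ ]
  ∃L    : ∀ {Γ Δ} φ y → ¬ FreeS y (`∃ φ ∷ Γ ⇒ Δ) →
          Rule (`∃ φ ∷ Γ ⇒ Δ) [ inst φ (fv y) ∷ Γ ⇒ Δ ]
  ∃R    : ∀ {Γ Δ} φ (t : Term 0) → Rule (Γ ⇒ `∃ φ ∷ Δ) [ Γ ⇒ inst φ t ∷ Δ ]
  eqRefl  : ∀ (t : Term 0) → Rule ([] ⇒ [ t `= t ]) []
  eqSubst : ∀ x (s t : Term 0) (φ : Fml) →
            Rule (s `= t ∷ fsubF x s φ ∷ [] ⇒ [ fsubF x t φ ]) []
  zeroNeS : ∀ (t : Term 0) → Rule ([] ⇒ [ `¬ (`0 `= `S t) ]) []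
  sInj    : ∀ (s t : Term 0) → Rule ([ `S s `= `S t ] ⇒ [ s `= t ]) []
  plus0   : ∀ (s : Term 0) → Rule ([] ⇒ [ s `+ `0 `= s ]) []
  plusS   : ∀ (s t : Term 0) → Rule ([] ⇒ [ s `+ `S t `= `S (s `+ t) ]) []
  times0  : ∀ (s : Term 0) → Rule ([] ⇒ [ s `· `0 `= `0 ]) []
  timesS  : ∀ (s t : Term 0) → Rule ([] ⇒ [ s `· `S t `= (s `· t) `+ s ]) []

stepσ : Fin 1 → Term 1
stepσ fz = `S (bv fz)

IndSequent : Formula 1 → Term 0 → Sequent
IndSequent φ s = inst φ `0 ∷ `∀ (φ `→ substF stepσ φ) ∷ [] ⇒ [ inst φ s ]

data PA⊢ : Sequent → Set where
  rule : ∀ {s ps} → Rule s ps → All PA⊢ ps → PA⊢ s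
  ind  : ∀ (φ : Formula 1) (s : Term 0) → PA⊢ (IndSequent φ s)

data CRule : Sequent → List Sequent → Set where
  base : ∀ {s ps} → Rule s ps → CRule s ps
  case : ∀ {s} x → CRule s (subS x `0 s ∷ subS x (`S (fv x)) s ∷ [])

Path : Set
Path = List ℕ

-- finite trees: inner nodes labelled by a rule instance, buds carrying a
-- sequent and the address of their companion
data PT : Set where
  inner : (s : Sequent) (ps : List Sequent) → CRule s ps → List PT → PT
  bud   : Sequent → Path → PT

seqOf : PT → Sequent
seqOf (inner s _ _ _) = s
seqOf (bud s _)       = s

mutual
  at : PT → Path → Maybe PT
  at t               []      = just t
  at (inner _ _ _ ts) (i ∷ p) = atL ts i p
  at (bud _ _)        (_ ∷ _) = nothing

  atL : List PT → ℕ → Path → Maybe PT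
  atL []       _       _ = nothing
  atL (t ∷ ts) zero    p = at t p
  atL (t ∷ ts) (suc i) p = atL ts i p

data WF (R : PT) : PT → Set where
  inner : ∀ {s ps r ts} → Pointwise (λ t p → seqOf t ≡ p) ts ps → All (WF R) ts →
          WF R (inner s ps r ts)
  bud   : ∀ {s q s' ps r ts} → at R q ≡ just (inner s' ps r ts) → s' ≡ s →
          WF R (bud s q)

data Step (T : PT) (p : Path) : Path → Set where
  child : ∀ {s ps r ts} i → at T p ≡ just (inner s ps r ts) → i < length ts →
          Step T p (p ∷ʳ i)
  link  : ∀ {s q} → at T p ≡ just (bud s q) → Step T p q

InfBranch : PT → (ℕ → Path) → Set
InfBranch T b = (b 0 ≡ []) × (∀ n → Step T (b n) (b (suc n)))

FreeAt : PT → ℕ → Path → Set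
FreeAt T x p = Σ PT λ t → (at T p ≡ just t) × FreeS x (seqOf t)

data IsCase (x : ℕ) : ∀ {s ps} → CRule s ps → Set where
  isCase : ∀ {s} → IsCase x (case {s} x)

CaseAt : PT → ℕ → Path → Set
CaseAt T x p = Σ Sequent λ s → Σ (List Sequent) λ ps → Σ (CRule s ps) λ r →
               Σ (List PT) λ ts → (at T p ≡ just (inner s ps r ts)) × IsCase x r

Progressing : PT → (ℕ → Path) → ℕ → Set
Progressing T b x =
  Σ ℕ λ N → (∀ n → N ≤ n → FreeAt T x (b n)) ×
            (∀ m → Σ ℕ λ n → m ≤ n × CaseAt T x (b n))

-- global trace condition (classical existential, stated with ¬¬)
CPAProof : PT → Set
CPAProof T = WF T T × (∀ b → InfBranch T b → ¬ ¬ (Σ ℕ λ x → Progressing T b x))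

CPA⊢ : Sequent → Set
CPA⊢ s = Σ PT λ T → (seqOf T ≡ s) × CPAProof T

{-# OPTIONS --safe #-}

-- View a cyclic proof as a finite graph and let S be a set of its nodes all of whose exits are derivable.
-- If S is not strongly connected, part of it can be cut off and treated first.  If it is, a closed walk
-- through all of S is an infinite branch, so some x is free throughout S and S contains a Case_x node:
-- along S the value of x never changes except that it drops at each Case_x.  Hence all sequents of S,
-- closed over the variables not kept fixed so far, follow simultaneously by induction on x: the induction
-- hypothesis derives the Case_x nodes, and what remains of S without them is smaller.
module Submission where

open import Defs
open import Data.Bool using (true; false; if_then_else_)
open import Data.Bool.Properties using (T-≡)
open import Data.Empty using (⊥-elim)
open import Data.Fin using (Fin; fromℕ; inject₁) renaming (zero to fz; suc to fs)
open import Data.List using (List; []; _∷_; [_]; map; length; _++_; filter; _∷ʳ_; applyUpTo)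
open import Data.List.Membership.Propositional using (_∈_; _∉_; find; lose)
open import Data.List.Membership.Propositional.Properties
  using (∈-++⁺ˡ; ∈-++⁺ʳ; ∈-++⁻; ∈-filter⁺; ∈-filter⁻; ∈-map⁺; ∈-map⁻; ∈-applyUpTo⁻)
open import Data.List.Properties as List using (map-++; ++-identityʳ; ∷ʳ-++; filter-notAll)
open import Data.List.Relation.Binary.Permutation.Propositional using (↭-sym)
open import Data.List.Relation.Binary.Permutation.Propositional.Properties using (∈-resp-↭; shift)
open import Data.List.Relation.Binary.Pointwise using (Pointwise; []; _∷_)
open import Data.List.Relation.Binary.Subset.Propositional using (_⊆_)
open import Data.List.Relation.Binary.Subset.Propositional.Properties using (xs⊆xs++ys; ++⁺ˡ; ++⁺ʳ)
open import Data.List.Relation.Unary.All as All using (All; []; _∷_)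
open import Data.List.Relation.Unary.All.Properties using (map⁺; ¬All⇒Any¬)
open import Data.List.Relation.Unary.Any as Any using (Any; here; there)
open import Data.List.Relation.Unary.Any.Properties using (++⁻)
open import Data.Maybe using (Maybe; just; nothing)
open import Data.Maybe.Properties as Maybe using ()
open import Data.Nat using (ℕ; zero; suc; _≤_; _<_; _≡ᵇ_; _≟_; s≤s; s≤s⁻¹; z≤n)
open import Data.Nat.ListAction using (sum)
open import Data.Nat.Properties
  using (≡ᵇ⇒≡; ≡⇒≡ᵇ; m≤m+n; m≤n+m; n≤1+n; m≤n⇒m≤1+n; ≤-refl; ≤-trans; <-irrefl)
open import Data.List.Membership.DecPropositional _≟_ using (_∈?_)
open import Data.Product using (Σ; _×_; _,_; proj₁; proj₂; map₂)
open import Data.Sum as Sum using (_⊎_; inj₁; inj₂)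
open import Function using (_∘_; id; case_of_)
open import Function.Bundles using (Equivalence)
open import Relation.Binary using (DecidableEquality)
open import Relation.Binary.Construct.Closure.ReflexiveTransitive using (Star; ε; _◅_; _◅◅_)
open import Relation.Binary.PropositionalEquality using (_≡_; _≢_; refl; sym; trans; cong; cong₂; subst)
open import Relation.Nullary using (¬_; Dec; yes; no; ¬?)
open import Relation.Nullary.Decidable using (_⊎-dec_; map′)

-- Substitution and free variables

≡ᵇ-refl : ∀ x → (x ≡ᵇ x) ≡ true
≡ᵇ-refl x = Equivalence.to T-≡ (≡⇒≡ᵇ x x refl)

≡ᵇ-sound : ∀ {x y} → (x ≡ᵇ y) ≡ true → x ≡ y
≡ᵇ-sound e = ≡ᵇ⇒≡ _ _ (Equivalence.from T-≡ e)

-- The abstracted variable becomes the outermost index, so that no index shifting is needed under binders.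
absT : ∀ {n} → ℕ → Term n → Term (suc n)
absT {n} x (fv y) = if x ≡ᵇ y then bv (fromℕ n) else fv y
absT x (bv i)     = bv (inject₁ i)
absT x `0         = `0
absT x (`S t)     = `S (absT x t)
absT x (s `+ t)   = absT x s `+ absT x t
absT x (s `· t)   = absT x s `· absT x t

absF : ∀ {n} → ℕ → Formula n → Formula (suc n)
absF x (s `= t) = absT x s `= absT x t
absF x `⊥       = `⊥
absF x (φ `∧ ψ) = absF x φ `∧ absF x ψ
absF x (φ `∨ ψ) = absF x φ `∨ absF x ψ
absF x (φ `→ ψ) = absF x φ `→ absF x ψ
absF x (`∀ φ)   = `∀ (absF x φ)
absF x (`∃ φ)   = `∃ (absF x φ)

ren-emb : ∀ {n} (t : Term 0) → renT fs (emb {n} t) ≡ emb t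
ren-emb (fv x)   = refl
ren-emb `0       = refl
ren-emb (`S t)   = cong `S (ren-emb t)
ren-emb (s `+ t) = cong₂ _`+_ (ren-emb s) (ren-emb t)
ren-emb (s `· t) = cong₂ _`·_ (ren-emb s) (ren-emb t)

emb-id : (t : Term 0) → emb t ≡ t
emb-id (fv x)   = refl
emb-id `0       = refl
emb-id (`S t)   = cong `S (emb-id t)
emb-id (s `+ t) = cong₂ _`+_ (emb-id s) (emb-id t)
emb-id (s `· t) = cong₂ _`·_ (emb-id s) (emb-id t)

-- The substitution inside `inst` is a local function. Equations at each index describe it without
-- naming it, and `lift` preserves them.
record Instantiates {n} (σ : Fin (suc n) → Term n) (t : Term 0) : Set where
  field
    low : ∀ i → σ (inject₁ i) ≡ bv i
    top : σ (fromℕ n) ≡ emb t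
open Instantiates

lift-instantiates : ∀ {n} {σ : Fin (suc n) → Term n} {t} → Instantiates σ t → Instantiates (lift σ) t
lift-instantiates h .low fz     = refl
lift-instantiates h .low (fs i) = cong (renT fs) (low h i)
lift-instantiates {t = t} h .top = trans (cong (renT fs) (top h)) (ren-emb t)

subst-absT : ∀ {n} {σ : Fin (suc n) → Term n} {t} x → Instantiates σ t → ∀ u → substT σ (absT x u) ≡ fsubT x t u
subst-absT x h (fv y) with x ≡ᵇ y
... | true  = top h
... | false = refl
subst-absT x h (bv i)   = low h i
subst-absT x h `0       = refl
subst-absT x h (`S u)   = cong `S (subst-absT x h u)
subst-absT x h (u `+ v) = cong₂ _`+_ (subst-absT x h u) (subst-absT x h v)
subst-absT x h (u `· v) = cong₂ _`·_ (subst-absT x h u) (subst-absT x h v)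

subst-absF : ∀ {n} {σ : Fin (suc n) → Term n} {t} x → Instantiates σ t → ∀ φ → substF σ (absF x φ) ≡ fsubF x t φ
subst-absF x h (s `= t) = cong₂ _`=_ (subst-absT x h s) (subst-absT x h t)
subst-absF x h `⊥       = refl
subst-absF x h (φ `∧ ψ) = cong₂ _`∧_ (subst-absF x h φ) (subst-absF x h ψ)
subst-absF x h (φ `∨ ψ) = cong₂ _`∨_ (subst-absF x h φ) (subst-absF x h ψ)
subst-absF x h (φ `→ ψ) = cong₂ _`→_ (subst-absF x h φ) (subst-absF x h ψ)
subst-absF x h (`∀ φ)   = cong `∀ (subst-absF x (lift-instantiates h) φ)
subst-absF x h (`∃ φ)   = cong `∃ (subst-absF x (lift-instantiates h) φ)

inst-abs : ∀ x φ t → inst (absF x φ) t ≡ fsubF x t φ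
inst-abs x φ t = subst-absF x (record { low = λ () ; top = sym (emb-id t) }) φ

record Increments {n} (σ : Fin (suc n) → Term (suc n)) : Set where
  field
    low : ∀ i → σ (inject₁ i) ≡ bv (inject₁ i)
    top : σ (fromℕ n) ≡ `S (bv (fromℕ n))

lift-increments : ∀ {n} {σ : Fin (suc n) → Term (suc n)} → Increments σ → Increments (lift σ)
lift-increments h .Increments.low fz     = refl
lift-increments h .Increments.low (fs i) = cong (renT fs) (Increments.low h i)
lift-increments h .Increments.top        = cong (renT fs) (Increments.top h)

step-absT : ∀ {n} {σ : Fin (suc n) → Term (suc n)} x → Increments σ →
            ∀ u → substT σ (absT x u) ≡ absT x (fsubT x (`S (fv x)) u)
step-absT x h (fv y) with x ≡ᵇ y in eq
... | false rewrite eq = refl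
... | true rewrite ≡ᵇ-refl x = Increments.top h
step-absT x h (bv i)   = Increments.low h i
step-absT x h `0       = refl
step-absT x h (`S u)   = cong `S (step-absT x h u)
step-absT x h (u `+ v) = cong₂ _`+_ (step-absT x h u) (step-absT x h v)
step-absT x h (u `· v) = cong₂ _`·_ (step-absT x h u) (step-absT x h v)

step-absF : ∀ {n} {σ : Fin (suc n) → Term (suc n)} x → Increments σ →
            ∀ φ → substF σ (absF x φ) ≡ absF x (fsubF x (`S (fv x)) φ)
step-absF x h (s `= t) = cong₂ _`=_ (step-absT x h s) (step-absT x h t)
step-absF x h `⊥       = refl
step-absF x h (φ `∧ ψ) = cong₂ _`∧_ (step-absF x h φ) (step-absF x h ψ)
step-absF x h (φ `∨ ψ) = cong₂ _`∨_ (step-absF x h φ) (step-absF x h ψ)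
step-absF x h (φ `→ ψ) = cong₂ _`→_ (step-absF x h φ) (step-absF x h ψ)
step-absF x h (`∀ φ)   = cong `∀ (step-absF x (lift-increments h) φ)
step-absF x h (`∃ φ)   = cong `∃ (step-absF x (lift-increments h) φ)

-- Presents the successor formula of `IndSequent` for `absF x φ` as an abstraction, so that it can
-- be obtained by generalising over `x`.
stepσ-abs : ∀ x φ → substF stepσ (absF x φ) ≡ absF x (fsubF x (`S (fv x)) φ)
stepσ-abs x φ = step-absF x (record { low = λ () ; top = refl }) φ

fsubT-self : ∀ {n} x (u : Term n) → fsubT x (fv x) u ≡ u
fsubT-self x (fv y) with x ≡ᵇ y in eq
... | true  = cong fv (≡ᵇ-sound eq)
... | false = refl
fsubT-self x (bv i)   = refl
fsubT-self x `0       = refl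
fsubT-self x (`S u)   = cong `S (fsubT-self x u)
fsubT-self x (u `+ v) = cong₂ _`+_ (fsubT-self x u) (fsubT-self x v)
fsubT-self x (u `· v) = cong₂ _`·_ (fsubT-self x u) (fsubT-self x v)

fsubF-self : ∀ {n} x (φ : Formula n) → fsubF x (fv x) φ ≡ φ
fsubF-self x (s `= t) = cong₂ _`=_ (fsubT-self x s) (fsubT-self x t)
fsubF-self x `⊥       = refl
fsubF-self x (φ `∧ ψ) = cong₂ _`∧_ (fsubF-self x φ) (fsubF-self x ψ)
fsubF-self x (φ `∨ ψ) = cong₂ _`∨_ (fsubF-self x φ) (fsubF-self x ψ)
fsubF-self x (φ `→ ψ) = cong₂ _`→_ (fsubF-self x φ) (fsubF-self x ψ)
fsubF-self x (`∀ φ)   = cong `∀ (fsubF-self x φ)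
fsubF-self x (`∃ φ)   = cong `∃ (fsubF-self x φ)

inst-abs-self : ∀ x φ → inst (absF x φ) (fv x) ≡ φ
inst-abs-self x φ = trans (inst-abs x φ (fv x)) (fsubF-self x φ)

fsubT-fresh : ∀ {n} x t (u : Term n) → ¬ FreeT x u → fsubT x t u ≡ u
fsubT-fresh x t (fv y) h with x ≡ᵇ y in eq
... | true  = ⊥-elim (h (≡ᵇ-sound eq))
... | false = refl
fsubT-fresh x t (bv i)   h = refl
fsubT-fresh x t `0       h = refl
fsubT-fresh x t (`S u)   h = cong `S (fsubT-fresh x t u h)
fsubT-fresh x t (u `+ v) h = cong₂ _`+_ (fsubT-fresh x t u (h ∘ inj₁)) (fsubT-fresh x t v (h ∘ inj₂))
fsubT-fresh x t (u `· v) h = cong₂ _`·_ (fsubT-fresh x t u (h ∘ inj₁)) (fsubT-fresh x t v (h ∘ inj₂))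

fsubF-fresh : ∀ {n} x t (φ : Formula n) → ¬ FreeF x φ → fsubF x t φ ≡ φ
fsubF-fresh x t (u `= v) h = cong₂ _`=_ (fsubT-fresh x t u (h ∘ inj₁)) (fsubT-fresh x t v (h ∘ inj₂))
fsubF-fresh x t `⊥       h = refl
fsubF-fresh x t (φ `∧ ψ) h = cong₂ _`∧_ (fsubF-fresh x t φ (h ∘ inj₁)) (fsubF-fresh x t ψ (h ∘ inj₂))
fsubF-fresh x t (φ `∨ ψ) h = cong₂ _`∨_ (fsubF-fresh x t φ (h ∘ inj₁)) (fsubF-fresh x t ψ (h ∘ inj₂))
fsubF-fresh x t (φ `→ ψ) h = cong₂ _`→_ (fsubF-fresh x t φ (h ∘ inj₁)) (fsubF-fresh x t ψ (h ∘ inj₂))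
fsubF-fresh x t (`∀ φ)   h = cong `∀ (fsubF-fresh x t φ h)
fsubF-fresh x t (`∃ φ)   h = cong `∃ (fsubF-fresh x t φ h)

map-fsubF-fresh : ∀ x t (Γ : List Fml) → ¬ Any (FreeF x) Γ → map (fsubF x t) Γ ≡ Γ
map-fsubF-fresh x t []      h = refl
map-fsubF-fresh x t (φ ∷ Γ) h = cong₂ _∷_ (fsubF-fresh x t φ (h ∘ here)) (map-fsubF-fresh x t Γ (h ∘ there))

free-absT : ∀ {n} x y (u : Term n) → FreeT y (absT x u) → y ≢ x × FreeT y u
free-absT x y (fv z) h with x ≡ᵇ z in eq
free-absT x y (fv .y) refl | false = (λ { refl → case trans (sym eq) (≡ᵇ-refl x) of λ () }) , refl
free-absT x y (`S u)   h = free-absT x y u h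
free-absT x y (u `+ v) (inj₁ h) = map₂ inj₁ (free-absT x y u h)
free-absT x y (u `+ v) (inj₂ h) = map₂ inj₂ (free-absT x y v h)
free-absT x y (u `· v) (inj₁ h) = map₂ inj₁ (free-absT x y u h)
free-absT x y (u `· v) (inj₂ h) = map₂ inj₂ (free-absT x y v h)

free-absF : ∀ {n} x y (φ : Formula n) → FreeF y (absF x φ) → y ≢ x × FreeF y φ
free-absF x y (u `= v) (inj₁ h) = map₂ inj₁ (free-absT x y u h)
free-absF x y (u `= v) (inj₂ h) = map₂ inj₂ (free-absT x y v h)
free-absF x y (φ `∧ ψ) (inj₁ h) = map₂ inj₁ (free-absF x y φ h)
free-absF x y (φ `∧ ψ) (inj₂ h) = map₂ inj₂ (free-absF x y ψ h)
free-absF x y (φ `∨ ψ) (inj₁ h) = map₂ inj₁ (free-absF x y φ h)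
free-absF x y (φ `∨ ψ) (inj₂ h) = map₂ inj₂ (free-absF x y ψ h)
free-absF x y (φ `→ ψ) (inj₁ h) = map₂ inj₁ (free-absF x y φ h)
free-absF x y (φ `→ ψ) (inj₂ h) = map₂ inj₂ (free-absF x y ψ h)
free-absF x y (`∀ φ)   h = free-absF x y φ h
free-absF x y (`∃ φ)   h = free-absF x y φ h

fsubT-0-fresh : ∀ {n} x (u : Term n) → ¬ FreeT x (fsubT x `0 u)
fsubT-0-fresh x (fv y) h with x ≡ᵇ y in eq
fsubT-0-fresh x (fv .x) refl | false with trans (sym eq) (≡ᵇ-refl x)
... | ()
fsubT-0-fresh x (`S u)   h = fsubT-0-fresh x u h
fsubT-0-fresh x (u `+ v) h = Sum.[ fsubT-0-fresh x u , fsubT-0-fresh x v ] h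
fsubT-0-fresh x (u `· v) h = Sum.[ fsubT-0-fresh x u , fsubT-0-fresh x v ] h

fsubF-0-fresh : ∀ {n} x (φ : Formula n) → ¬ FreeF x (fsubF x `0 φ)
fsubF-0-fresh x (u `= v) h = Sum.[ fsubT-0-fresh x u , fsubT-0-fresh x v ] h
fsubF-0-fresh x (φ `∧ ψ) h = Sum.[ fsubF-0-fresh x φ , fsubF-0-fresh x ψ ] h
fsubF-0-fresh x (φ `∨ ψ) h = Sum.[ fsubF-0-fresh x φ , fsubF-0-fresh x ψ ] h
fsubF-0-fresh x (φ `→ ψ) h = Sum.[ fsubF-0-fresh x φ , fsubF-0-fresh x ψ ] h
fsubF-0-fresh x (`∀ φ)   h = fsubF-0-fresh x φ h
fsubF-0-fresh x (`∃ φ)   h = fsubF-0-fresh x φ h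

-- Consequently the zero premise of a `case x` node always lies outside a component throughout which
-- `x` is free.
subS-0-fresh : ∀ x s → ¬ FreeS x (subS x `0 s)
subS-0-fresh x (Γ ⇒ Δ) = Sum.[ none Γ , none Δ ]
  where
  none : ∀ Γ → ¬ Any (FreeF x) (map (fsubF x `0) Γ)
  none (φ ∷ Γ) (here h)  = fsubF-0-fresh x φ h
  none (φ ∷ Γ) (there h) = none Γ h

-- Lists of free variables and decidability of freeness

fvT : ∀ {n} → Term n → List ℕ
fvT (fv x)   = [ x ]
fvT (bv i)   = []
fvT `0       = []
fvT (`S t)   = fvT t
fvT (s `+ t) = fvT s ++ fvT t
fvT (s `· t) = fvT s ++ fvT t

fvF : ∀ {n} → Formula n → List ℕ
fvF (s `= t) = fvT s ++ fvT t
fvF `⊥       = []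
fvF (φ `∧ ψ) = fvF φ ++ fvF ψ
fvF (φ `∨ ψ) = fvF φ ++ fvF ψ
fvF (φ `→ ψ) = fvF φ ++ fvF ψ
fvF (`∀ φ)   = fvF φ
fvF (`∃ φ)   = fvF φ

∈-++-⊎ : ∀ {x : ℕ} {A B : Set} {xs ys} → (A → x ∈ xs) → (B → x ∈ ys) → A ⊎ B → x ∈ xs ++ ys
∈-++-⊎ {xs = xs} f g = Sum.[ ∈-++⁺ˡ ∘ f , ∈-++⁺ʳ xs ∘ g ]

free⇒∈fvT : ∀ {n} x (u : Term n) → FreeT x u → x ∈ fvT u
free⇒∈fvT x (fv y)   h = here h
free⇒∈fvT x (`S u)   h = free⇒∈fvT x u h
free⇒∈fvT x (u `+ v) h = ∈-++-⊎ (free⇒∈fvT x u) (free⇒∈fvT x v) h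
free⇒∈fvT x (u `· v) h = ∈-++-⊎ (free⇒∈fvT x u) (free⇒∈fvT x v) h

free⇒∈fvF : ∀ {n} x (φ : Formula n) → FreeF x φ → x ∈ fvF φ
free⇒∈fvF x (u `= v) h = ∈-++-⊎ (free⇒∈fvT x u) (free⇒∈fvT x v) h
free⇒∈fvF x (φ `∧ ψ) h = ∈-++-⊎ (free⇒∈fvF x φ) (free⇒∈fvF x ψ) h
free⇒∈fvF x (φ `∨ ψ) h = ∈-++-⊎ (free⇒∈fvF x φ) (free⇒∈fvF x ψ) h
free⇒∈fvF x (φ `→ ψ) h = ∈-++-⊎ (free⇒∈fvF x φ) (free⇒∈fvF x ψ) h
free⇒∈fvF x (`∀ φ)   h = free⇒∈fvF x φ h
free⇒∈fvF x (`∃ φ)   h = free⇒∈fvF x φ h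

freeT? : ∀ {n} x (u : Term n) → Dec (FreeT x u)
freeT? x (fv y)   = x ≟ y
freeT? x (bv i)   = no id
freeT? x `0       = no id
freeT? x (`S u)   = freeT? x u
freeT? x (u `+ v) = freeT? x u ⊎-dec freeT? x v
freeT? x (u `· v) = freeT? x u ⊎-dec freeT? x v

freeF? : ∀ {n} x (φ : Formula n) → Dec (FreeF x φ)
freeF? x (u `= v) = freeT? x u ⊎-dec freeT? x v
freeF? x `⊥       = no id
freeF? x (φ `∧ ψ) = freeF? x φ ⊎-dec freeF? x ψ
freeF? x (φ `∨ ψ) = freeF? x φ ⊎-dec freeF? x ψ
freeF? x (φ `→ ψ) = freeF? x φ ⊎-dec freeF? x ψ
freeF? x (`∀ φ)   = freeF? x φ
freeF? x (`∃ φ)   = freeF? x φ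

freeS? : ∀ x s → Dec (FreeS x s)
freeS? x (Γ ⇒ Δ) = Any.any? (freeF? x) Γ ⊎-dec Any.any? (freeF? x) Δ

∈⇒≤sum : ∀ {x xs} → x ∈ xs → x ≤ sum xs
∈⇒≤sum {x} (here refl)       = m≤m+n x _
∈⇒≤sum {x} {y ∷ _} (there i) = ≤-trans (∈⇒≤sum i) (m≤n+m _ y)

fresh : (xs : List ℕ) → Σ ℕ (_∉ xs)
fresh xs = suc (sum xs) , λ i → <-irrefl refl (∈⇒≤sum i)

-- Derived rules of PA

private variable
  Γ Δ Γ' Δ' Θ : List Fml
  φ ψ : Fml

weakenL : ∀ Θ → PA⊢ (Γ ⇒ Δ) → PA⊢ (Θ ++ Γ ⇒ Δ)
weakenL []      d = d
weakenL (φ ∷ Θ) d = rule (wkL φ) (weakenL Θ d ∷ [])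

weakenR : ∀ Θ → PA⊢ (Γ ⇒ Δ) → PA⊢ (Γ ⇒ Θ ++ Δ)
weakenR []      d = d
weakenR (φ ∷ Θ) d = rule (wkR φ) (weakenR Θ d ∷ [])

⊆⇒≋ : Γ ⊆ Γ' → Γ' ≋ (Γ' ++ Γ)
⊆⇒≋ {Γ' = Γ'} i φ = ∈-++⁺ˡ , λ j → Sum.[ id , i ] (∈-++⁻ Γ' j)

-- Read upwards, `str` replaces `Γ'` by `Γ' ++ Γ`, which has the same elements, and the copy of `Γ'`
-- is then removed by weakening; likewise on the right.
weaken : Γ ⊆ Γ' → Δ ⊆ Δ' → PA⊢ (Γ ⇒ Δ) → PA⊢ (Γ' ⇒ Δ')
weaken {Γ' = Γ'} {Δ' = Δ'} i j d = rule (str (⊆⇒≋ i) (⊆⇒≋ j)) (weakenL Γ' (weakenR Δ' d) ∷ [])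

wkˡ : Γ ⊆ Γ' → PA⊢ (Γ ⇒ Δ) → PA⊢ (Γ' ⇒ Δ)
wkˡ i = weaken i id

[-]⊆ : φ ∈ Γ → [ φ ] ⊆ Γ
[-]⊆ i (here refl) = i

head⊆ : ∀ {φ : Fml} {Δ} → [ φ ] ⊆ φ ∷ Δ
head⊆ = [-]⊆ (here refl)

hyp : φ ∈ Γ → PA⊢ (Γ ⇒ [ φ ])
hyp i = wkˡ ([-]⊆ i) (rule (ax _) [])

rewriteR : φ ≡ ψ → PA⊢ (Γ ⇒ [ φ ]) → PA⊢ (Γ ⇒ [ ψ ])
rewriteR e = subst (λ φ → PA⊢ (_ ⇒ [ φ ])) e

axiom : PA⊢ ([] ⇒ Δ) → PA⊢ (Γ ⇒ Δ)
axiom = wkˡ λ ()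

cut₁ : PA⊢ (Γ ⇒ [ φ ]) → PA⊢ (φ ∷ Γ ⇒ Δ) → PA⊢ (Γ ⇒ Δ)
cut₁ d e = rule (cut _) (weaken id head⊆ d ∷ e ∷ [])

→I : PA⊢ (φ ∷ Γ ⇒ [ ψ ]) → PA⊢ (Γ ⇒ [ φ `→ ψ ])
→I d = rule (→R _ _) (d ∷ [])

→E : PA⊢ (Γ ⇒ [ φ `→ ψ ]) → PA⊢ (Γ ⇒ [ φ ]) → PA⊢ (Γ ⇒ [ ψ ])
→E d e = cut₁ d (rule (→L _ _) (weaken id head⊆ e ∷ hyp (here refl) ∷ []))

∧I : PA⊢ (Γ ⇒ [ φ ]) → PA⊢ (Γ ⇒ [ ψ ]) → PA⊢ (Γ ⇒ [ φ `∧ ψ ])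
∧I d e = rule (∧R _ _) (d ∷ e ∷ [])

∧E₁ : PA⊢ (Γ ⇒ [ φ `∧ ψ ]) → PA⊢ (Γ ⇒ [ φ ])
∧E₁ d = cut₁ d (rule (∧L _ _) (hyp (here refl) ∷ []))

∧E₂ : PA⊢ (Γ ⇒ [ φ `∧ ψ ]) → PA⊢ (Γ ⇒ [ ψ ])
∧E₂ d = cut₁ d (rule (∧L _ _) (hyp (there (here refl)) ∷ []))

∀I : ∀ {Γ φ} y → ¬ Any (FreeF y) Γ → ¬ FreeF y φ → PA⊢ (Γ ⇒ [ inst φ (fv y) ]) → PA⊢ (Γ ⇒ [ `∀ φ ])
∀I y y∉Γ y∉φ d = rule (∀R _ y λ { (inj₁ h) → y∉Γ h ; (inj₂ (here h)) → y∉φ h }) (d ∷ [])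

∀E : ∀ {Γ φ} → PA⊢ (Γ ⇒ [ `∀ φ ]) → ∀ t → PA⊢ (Γ ⇒ [ inst φ t ])
∀E d t = cut₁ d (rule (∀L _ t) (hyp (here refl) ∷ []))

⊥E : PA⊢ (Γ ⇒ [ `⊥ ]) → PA⊢ (Γ ⇒ Δ)
⊥E d = cut₁ d (weaken head⊆ (λ ()) (rule ⊥L []))

-- The induction axiom is taken for `absF x P` at the term `x` itself, and two cuts supply its
-- antecedents. Since `x` is not free in `Γ`, the step can be generalised over `x`.
induction : ∀ x P → ¬ Any (FreeF x) Γ →
            PA⊢ (Γ ⇒ [ fsubF x `0 P ]) → PA⊢ (P ∷ Γ ⇒ [ fsubF x (`S (fv x)) P ]) → PA⊢ (Γ ⇒ [ P ])
induction {Γ} x P x∉Γ d₀ dₛ =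
  cut₁ (rewriteR (sym (inst-abs x P `0)) d₀)
  (cut₁ (wkˡ there all-steps)
  (rewriteR (inst-abs-self x P)
    (wkˡ (λ { (here refl) → there (here refl) ; (there (here refl)) → here refl }) (ind (absF x P) (fv x)))))
  where
  P⁺ = fsubF x (`S (fv x)) P
  step-inst : PA⊢ (Γ ⇒ [ inst (absF x P `→ absF x P⁺) (fv x) ])
  step-inst = rewriteR
    (sym (cong₂ _`→_ (inst-abs-self x P) (inst-abs-self x P⁺))) (→I dₛ)
  x∉ : ¬ FreeF x (absF x P `→ absF x P⁺)
  x∉ (inj₁ h) = proj₁ (free-absF x x P h) refl
  x∉ (inj₂ h) = proj₁ (free-absF x x P⁺ h) refl
  all-steps : PA⊢ (Γ ⇒ [ `∀ (absF x P `→ substF stepσ (absF x P)) ])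
  all-steps = subst (λ φ → PA⊢ (Γ ⇒ [ `∀ (absF x P `→ φ) ])) (sym (stepσ-abs x P)) (∀I x x∉Γ x∉ step-inst)

-- Sequents as formulas

disj : List Fml → Fml
disj []      = `⊥
disj (φ ∷ Δ) = φ `∨ disj Δ

seqF : Sequent → Fml
seqF ([] ⇒ Δ)    = disj Δ
seqF (φ ∷ Γ ⇒ Δ) = φ `→ seqF (Γ ⇒ Δ)

shift⊆ : ∀ (φ : Fml) Γ Θ → Γ ++ φ ∷ Θ ⊆ φ ∷ Γ ++ Θ
shift⊆ φ Γ Θ = ∈-resp-↭ (shift φ Γ Θ)

shift⊇ : ∀ (φ : Fml) Γ Θ → φ ∷ Γ ++ Θ ⊆ Γ ++ φ ∷ Θ
shift⊇ φ Γ Θ = ∈-resp-↭ (↭-sym (shift φ Γ Θ))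

-- `Θ` holds the disjuncts already split off while the recursion assembles the rest.
disjI : ∀ Δ → PA⊢ (Γ ⇒ Δ ++ Θ) → PA⊢ (Γ ⇒ disj Δ ∷ Θ)
disjI []      d = rule (wkR `⊥) (d ∷ [])
disjI {Θ = Θ} (φ ∷ Δ) d =
  rule (∨R φ (disj Δ)) (weaken id swap (disjI Δ (weaken id (shift⊇ φ Δ Θ) d)) ∷ [])
  where
  swap : disj Δ ∷ φ ∷ Θ ⊆ φ ∷ disj Δ ∷ Θ
  swap = shift⊆ φ [ disj Δ ] Θ

disjE : ∀ Δ → PA⊢ (disj Δ ∷ Γ ⇒ Δ)
disjE []      = ⊥E (hyp (here refl))
disjE (φ ∷ Δ) = rule (∨L φ (disj Δ)) (weaken head⊆ head⊆ (rule (ax φ) []) ∷ rule (wkR φ) (disjE Δ ∷ []) ∷ [])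

infix 2 _⊢_
-- The context stands behind `Γ` so that a left rule still finds its principal formula at the head
-- of the antecedent.
_⊢_ : List Fml → Sequent → Set
C ⊢ (Γ ⇒ Δ) = PA⊢ (Γ ++ C ⇒ Δ)

⊢-mono : ∀ {C C'} s → C ⊆ C' → C ⊢ s → C' ⊢ s
⊢-mono (Γ ⇒ Δ) i = wkˡ (++⁺ʳ Γ i)

seqFI : ∀ {C} s → C ⊢ s → PA⊢ (C ⇒ [ seqF s ])
seqFI ([] ⇒ Δ)    d = disjI Δ (weaken id ∈-++⁺ˡ d)
seqFI {C} (φ ∷ Γ ⇒ Δ) d = →I (seqFI (Γ ⇒ Δ) (wkˡ (shift⊇ φ Γ C) d))

seqFE : ∀ {C} s → PA⊢ (C ⇒ [ seqF s ]) → C ⊢ s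
seqFE ([] ⇒ Δ)    d = cut₁ d (disjE Δ)
seqFE {C} (φ ∷ Γ ⇒ Δ) d =
  wkˡ (shift⊆ φ Γ C) (seqFE (Γ ⇒ Δ) (→E (wkˡ there d) (hyp (here refl))))

disj-fsub : ∀ x t Δ → fsubF x t (disj Δ) ≡ disj (map (fsubF x t) Δ)
disj-fsub x t []      = refl
disj-fsub x t (φ ∷ Δ) = cong (_ `∨_) (disj-fsub x t Δ)

seqF-fsub : ∀ x t s → fsubF x t (seqF s) ≡ seqF (subS x t s)
seqF-fsub x t ([] ⇒ Δ)    = disj-fsub x t Δ
seqF-fsub x t (φ ∷ Γ ⇒ Δ) = cong (_ `→_) (seqF-fsub x t (Γ ⇒ Δ))

-- Case is induction whose step does not use the induction hypothesis.
case-PA : ∀ x s → PA⊢ (subS x `0 s) → PA⊢ (subS x (`S (fv x)) s) → PA⊢ s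
case-PA x s@(Γ ⇒ Δ) d e =
  subst (λ Γ → PA⊢ (Γ ⇒ Δ)) (++-identityʳ Γ) (seqFE {[]} s
    (induction x (seqF s) (λ ()) (formula d) (axiom (formula e))))
  where
  formula : ∀ {t} → PA⊢ (subS x t s) → PA⊢ ([] ⇒ [ fsubF x t (seqF s) ])
  formula {t} d = rewriteR (sym (seqF-fsub x t s))
    (seqFI (subS x t s) (wkˡ (xs⊆xs++ys _ _) d))

-- The context may mention `x` and is substituted into as well. This is how an induction hypothesis
-- about `x` becomes one about `S x` in the successor premise.
case-under : ∀ C x s → map (fsubF x `0) C ⊢ subS x `0 s → map (fsubF x (`S (fv x))) C ⊢ subS x (`S (fv x)) s → C ⊢ s
case-under C x (Γ ⇒ Δ) d e = case-PA x (Γ ++ C ⇒ Δ) (distribute d) (distribute e)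
  where
  distribute : ∀ {t} → map (fsubF x t) C ⊢ subS x t (Γ ⇒ Δ) → PA⊢ (subS x t (Γ ++ C ⇒ Δ))
  distribute {t} = subst (λ Γ' → PA⊢ (Γ' ⇒ _)) (sym (map-++ (fsubF x t) Γ C))

notFree-++ : ∀ C {y Γ Δ} → ¬ FreeS y (Γ ⇒ Δ) → ¬ Any (FreeF y) C → ¬ FreeS y (Γ ++ C ⇒ Δ)
notFree-++ C {Γ = Γ} h k (inj₁ p) = Sum.[ h ∘ inj₁ , k ] (++⁻ Γ p)
notFree-++ C h k (inj₂ p) = h (inj₂ p)

++≋ : ∀ C {Γ Γ'} → Γ ≋ Γ' → (Γ ++ C) ≋ (Γ' ++ C)
++≋ C e φ = ++⁺ˡ C (λ {ψ} → proj₁ (e ψ)) , ++⁺ˡ C (λ {ψ} → proj₂ (e ψ))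

-- An eigenvariable is not free in the conclusion, hence by the condition on `C` not free in `C`
-- either. Axioms absorb `C` by weakening.
rule-under : ∀ C {s ps} → (∀ y → ¬ FreeS y s → ¬ Any (FreeF y) C) → Rule s ps → All (C ⊢_) ps → C ⊢ s
rule-under C f (ax φ)           ds           = hyp (here refl)
rule-under C f ⊥L               ds           = ⊥E (hyp (here refl))
rule-under C f (str e e')       (d ∷ [])     = rule (str (++≋ C e) e') (d ∷ [])
rule-under C f (wkL φ)          (d ∷ [])     = rule (wkL φ) (d ∷ [])
rule-under C f (wkR φ)          (d ∷ [])     = rule (wkR φ) (d ∷ [])
rule-under C f (cut φ)          (d ∷ e ∷ []) = rule (cut φ) (d ∷ e ∷ [])
rule-under C f (∧L φ ψ)         (d ∷ [])     = rule (∧L φ ψ) (d ∷ [])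
rule-under C f (∧R φ ψ)         (d ∷ e ∷ []) = rule (∧R φ ψ) (d ∷ e ∷ [])
rule-under C f (∨L φ ψ)         (d ∷ e ∷ []) = rule (∨L φ ψ) (d ∷ e ∷ [])
rule-under C f (∨R φ ψ)         (d ∷ [])     = rule (∨R φ ψ) (d ∷ [])
rule-under C f (→L φ ψ)         (d ∷ e ∷ []) = rule (→L φ ψ) (d ∷ e ∷ [])
rule-under C f (→R φ ψ)         (d ∷ [])     = rule (→R φ ψ) (d ∷ [])
rule-under C f (∀L φ t)         (d ∷ [])     = rule (∀L φ t) (d ∷ [])
rule-under C f (∀R φ y h)       (d ∷ [])     = rule (∀R φ y (notFree-++ C h (f y h))) (d ∷ [])
rule-under C f (∃L {Γ} φ y h)   (d ∷ [])     = rule (∃L φ y (notFree-++ C {Γ = _ ∷ Γ} h (f y h))) (d ∷ [])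
rule-under C f (∃R φ t)         (d ∷ [])     = rule (∃R φ t) (d ∷ [])
rule-under C f r@(eqRefl _)        []        = axiom (rule r [])
rule-under C f r@(eqSubst _ _ _ _) []        = wkˡ ∈-++⁺ˡ (rule r [])
rule-under C f r@(zeroNeS _)       []        = axiom (rule r [])
rule-under C f r@(sInj _ _)        []        = wkˡ ∈-++⁺ˡ (rule r [])
rule-under C f r@(plus0 _)         []        = axiom (rule r [])
rule-under C f r@(plusS _ _)       []        = axiom (rule r [])
rule-under C f r@(times0 _)        []        = axiom (rule r [])
rule-under C f r@(timesS _ _)      []        = axiom (rule r [])

-- Universal closures and finite conjunctions

close : List ℕ → Fml → Fml
close []       φ = φ
close (y ∷ ys) φ = `∀ (absF y (close ys φ))

free-close : ∀ ys {x} → FreeF x (close ys φ) → x ∉ ys × FreeF x φ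
free-close []       h = (λ ()) , h
free-close (y ∷ ys) h with free-absF y _ (close ys _) h
... | x≢y , h' with free-close ys h'
... | x∉ys , h'' = (λ { (here e) → x≢y e ; (there i) → x∉ys i }) , h''

closeE : ∀ ys → PA⊢ (Γ ⇒ [ close ys φ ]) → PA⊢ (Γ ⇒ [ φ ])
closeE []       d = d
closeE (y ∷ ys) d = closeE ys (rewriteR (inst-abs-self y (close ys _)) (∀E d (fv y)))

closeI : ∀ ys → (∀ {y} → y ∈ ys → ¬ Any (FreeF y) Γ) → PA⊢ (Γ ⇒ [ φ ]) → PA⊢ (Γ ⇒ [ close ys φ ])
closeI []       h d = d
closeI {φ = φ} (y ∷ ys) h d =
  ∀I y (h (here refl)) (λ k → proj₁ (free-absF y y (close ys φ) k) refl)
    (rewriteR (sym (inst-abs-self y (close ys φ))) (closeI ys (h ∘ there) d))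

closeExcept : List ℕ → Fml → Fml
closeExcept X φ = close (filter (¬? ∘ (_∈? X)) (fvF φ)) φ

free-closeExcept : ∀ X φ {x} → FreeF x (closeExcept X φ) → x ∈ X
free-closeExcept X φ {x} h with x ∈? X
... | yes i = i
... | no x∉X with free-close (filter (¬? ∘ (_∈? X)) (fvF φ)) h
...   | x∉ , h' = ⊥-elim (x∉ (∈-filter⁺ (¬? ∘ (_∈? X)) (free⇒∈fvF x φ h') x∉X))

-- The quantified variables lie outside `X`, whereas the context mentions only variables in `X`, so
-- every eigenvariable condition holds.
closeExceptI : ∀ X φ → (∀ {y} → Any (FreeF y) Γ → y ∈ X) → PA⊢ (Γ ⇒ [ φ ]) → PA⊢ (Γ ⇒ [ closeExcept X φ ])
closeExceptI X φ h = closeI _ (λ i k → proj₂ (∈-filter⁻ (¬? ∘ (_∈? X)) {xs = fvF φ} i) (h k))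

conj : List Fml → Fml
conj []      = `⊥ `→ `⊥
conj (φ ∷ Γ) = φ `∧ conj Γ

conjI : ∀ Δ → (∀ {φ} → φ ∈ Δ → PA⊢ (Γ ⇒ [ φ ])) → PA⊢ (Γ ⇒ [ conj Δ ])
conjI []      d = →I (hyp (here refl))
conjI (φ ∷ Δ) d = ∧I (d (here refl)) (conjI Δ (d ∘ there))

conjE : φ ∈ Δ → PA⊢ (Γ ⇒ [ conj Δ ]) → PA⊢ (Γ ⇒ [ φ ])
conjE (here refl) d = ∧E₁ d
conjE (there i)   d = conjE i (∧E₂ d)

free-conj : ∀ Δ {x} → FreeF x (conj Δ) → Any (FreeF x) Δ
free-conj []      (inj₁ ())
free-conj []      (inj₂ ())
free-conj (φ ∷ Δ) (inj₁ h) = here h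
free-conj (φ ∷ Δ) (inj₂ h) = there (free-conj Δ h)

-- Vacuous at x = 0.
atPred : ℕ → Fml → Fml
atPred x P = `∀ (fv x `= `S (bv fz) `→ absF x P)

free-atPred : ∀ x P {y} → FreeF y (atPred x P) → y ≡ x ⊎ FreeF y P
free-atPred x P (inj₁ (inj₁ h)) = inj₁ h
free-atPred x P (inj₂ h)        = inj₂ (proj₂ (free-absF x _ P h))

-- In `absF x P` the variable `x` has become bound, so the substitution reaches only the guard.
fsub-atPred : ∀ x P t → fsubF x t (atPred x P) ≡ `∀ (emb t `= `S (bv fz) `→ absF x P)
fsub-atPred x P t rewrite ≡ᵇ-refl x | fsubF-fresh x t (absF x P) (λ h → proj₁ (free-absF x x P h) refl) = refl

atPred-0 : ∀ x P → PA⊢ (Γ ⇒ [ fsubF x `0 (atPred x P) ])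
atPred-0 {Γ} x P with fresh (fvF P)
... | z , z∉ = rewriteR (sym (fsub-atPred x P `0))
  (axiom (∀I z (λ ()) (λ { (inj₁ (inj₁ ())) ; (inj₁ (inj₂ ())) ; (inj₂ h) → z∉ (free⇒∈fvF z P (proj₂ (free-absF x z P h))) })
    (→I (⊥E (→E (axiom (rule (zeroNeS (fv z)) [])) (hyp (here refl)))))))

-- From the guard `S x = S z`, injectivity gives `x = z`, and `eqSubst` carries `P` from `x` to `z`.
atPred-S-I : ∀ x P → P ∈ Γ → PA⊢ (Γ ⇒ [ fsubF x (`S (fv x)) (atPred x P) ])
atPred-S-I {Γ} x P i with fresh (x ∷ fvF P)
... | z , z∉ = rewriteR (sym (fsub-atPred x P (`S (fv x))))
  (wkˡ ([-]⊆ i) (∀I z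
    (λ { (here h) → z∉ (there (free⇒∈fvF z P h)) })
    (λ { (inj₁ (inj₁ h)) → z∉ (here h)
       ; (inj₂ h) → z∉ (there (free⇒∈fvF z P (proj₂ (free-absF x z P h)))) })
    (→I (rewriteR (sym (inst-abs x P (fv z)))
      (cut₁ (wkˡ head⊆ (rule (sInj (fv x) (fv z)) []))
        (wkˡ (λ { (here refl) → here refl ; (there (here refl)) → there (there (here (fsubF-self x P))) })
          (rule (eqSubst x (fv x) (fv z) P) [])))))))

-- The bound predecessor is instantiated by `x`, which turns the guard into `S x = S x`.
atPred-S-E : ∀ x P → PA⊢ (Γ ⇒ [ fsubF x (`S (fv x)) (atPred x P) ]) → PA⊢ (Γ ⇒ [ P ])
atPred-S-E {Γ} x P d =
  rewriteR (inst-abs-self x P)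
    (→E (∀E (rewriteR (fsub-atPred x P (`S (fv x))) d) (fv x))
        (axiom (rule (eqRefl (`S (fv x))) [])))

-- The assumption is generalised over `x` and used at `0`, where the hypothesis is vacuous, and at
-- `S x`, where it amounts to `P`. This form lets a whole component be derived at one fixed `x`,
-- with its `Case` nodes looking back to the predecessor.
pred-induction : ∀ x P → ¬ Any (FreeF x) Γ → PA⊢ (atPred x P ∷ Γ ⇒ [ P ]) → PA⊢ (Γ ⇒ [ P ])
pred-induction {Γ} x P x∉Γ d =
  induction x P x∉Γ (→E (instance-at `0) (atPred-0 x P))
    (→E (wkˡ there (instance-at (`S (fv x)))) (atPred-S-I x P (here refl)))
  where
  Q = atPred x P `→ P
  general : PA⊢ (Γ ⇒ [ `∀ (absF x Q) ])
  general = ∀I x x∉Γ (λ h → proj₁ (free-absF x x Q h) refl)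
    (rewriteR (sym (inst-abs-self x Q)) (→I d))
  instance-at : ∀ t → PA⊢ (Γ ⇒ [ fsubF x t Q ])
  instance-at t = rewriteR (inst-abs x Q t) (∀E general t)

-- Cyclic proofs as graphs

data GRule : Maybe ℕ → Sequent → List Sequent → Set where
  base : ∀ {s ps} → Rule s ps → GRule nothing s ps
  link : ∀ {s} → GRule nothing s [ s ]
  case : ∀ {s} x → GRule (just x) s (subS x `0 s ∷ subS x (`S (fv x)) s ∷ [])

-- A bud is a node whose only successor is its companion.
record ProofGraph : Set₁ where
  field
    Node       : Set
    _≟ᴺ_       : DecidableEquality Node
    seq        : Node → Sequent
    succs      : Node → List Node
    caseVar    : Node → Maybe ℕ
    Valid      : Node → Set
    local-rule : ∀ {v} → Valid v → GRule (caseVar v) (seq v) (map seq (succs v))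

  TraceOn : (ℕ → Node) → Set
  TraceOn b = Σ ℕ λ x →
    (Σ ℕ λ N → ∀ n → N ≤ n → FreeS x (seq (b n))) × (∀ m → Σ ℕ λ n → m ≤ n × caseVar (b n) ≡ just x)

  field
    trace : ∀ b → Valid (b 0) → (∀ n → b (suc n) ∈ succs (b n)) → ¬ ¬ TraceOn b

-- Reachability, closed walks and induction along strongly connected components

module Unfolding (G : ProofGraph) where
  open ProofGraph G
  open import Data.List.Membership.DecPropositional _≟ᴺ_ using () renaming (_∈?_ to _∈ᴺ?_)

  EdgeIn : List Node → Node → Node → Set
  EdgeIn S v w = w ∈ succs v × w ∈ S

  Closed : List Node → List Node → Set
  Closed S R = ∀ {v w} → v ∈ R → w ∈ succs v → w ∈ S → w ∈ R

  module _ (S : List Node) (u : Node) where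

    ReachedFrom : List Node → Set
    ReachedFrom R = ∀ {w} → w ∈ R → Star (EdgeIn S) u w

    -- `U` lists the nodes of `S` possibly not yet reached and `n` bounds its length. Each round
    -- moves one successor of `R` from `U` to `R`; when there is none, `R` is closed.
    saturate : ∀ n R U → length U ≤ n → S ⊆ R ++ U → U ⊆ S → ReachedFrom R → u ∈ R →
               Σ (List Node) λ R' → u ∈ R' × Closed S R' × ReachedFrom R'
    saturate n R U U≤n cover U⊆S reached u∈R with Any.any? (λ w → Any.any? (λ r → w ∈ᴺ? succs r) R) U
    ... | no none = R , u∈R , closed , reached
      where
      closed : Closed S R
      closed v∈R e w∈S with ∈-++⁻ R (cover w∈S)
      ... | inj₁ w∈R = w∈R
      ... | inj₂ w∈U = ⊥-elim (none (lose w∈U (lose v∈R e)))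
    ... | yes some with find some
    saturate zero R (_ ∷ _) () cover U⊆S reached u∈R | yes some | w , w∈U , frontier
    saturate (suc n) R U U≤n cover U⊆S reached u∈R | yes some | w , w∈U , frontier
      with find frontier
    ... | r , r∈R , e =
      saturate n (w ∷ R) (filter ≢w? U)
        (s≤s⁻¹ (≤-trans (filter-notAll ≢w? U (lose w∈U (λ h → h refl))) U≤n))
        cover' (U⊆S ∘ proj₁ ∘ ∈-filter⁻ ≢w?) reached' (there u∈R)
      where
      ≢w? = λ v → ¬? (v ≟ᴺ w)
      cover' : S ⊆ (w ∷ R) ++ filter ≢w? U
      cover' {v} v∈S with ∈-++⁻ R (cover v∈S)
      ... | inj₁ v∈R = there (∈-++⁺ˡ v∈R)
      ... | inj₂ v∈U with v ≟ᴺ w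
      ...   | yes refl = here refl
      ...   | no v≢w = there (∈-++⁺ʳ R (∈-filter⁺ ≢w? v∈U v≢w))
      reached' : ReachedFrom (w ∷ R)
      reached' (here refl) = reached r∈R ◅◅ ((e , U⊆S w∈U) ◅ ε)
      reached' (there i)   = reached i

    reachable : Σ (List Node) λ R → u ∈ R × Closed S R × ReachedFrom R
    reachable = saturate (length S) [ u ] S ≤-refl there id (λ { (here refl) → ε }) (here refl)

  StronglyConnected : List Node → Set
  StronglyConnected S = ∀ {u w} → u ∈ S → w ∈ S → Star (EdgeIn S) u w

  Splitting : List Node → Set
  Splitting S = Σ (List Node) λ R → Closed S R × Any (_∈ R) S × Any (_∉ R) S

  -- If some `u` in `S` fails to reach all of `S`, the set reachable from `u` is the splitting: it
  -- contains `u` and misses a node.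
  connected-or-split : ∀ S → StronglyConnected S ⊎ Splitting S
  connected-or-split S with All.all? (λ u → All.all? (_∈ᴺ? proj₁ (reachable S u)) S) S
  ... | yes conn = inj₁ λ {u} u∈S w∈S → proj₂ (proj₂ (proj₂ (reachable S u))) (All.lookup (All.lookup conn u∈S) w∈S)
  ... | no ¬conn with find (¬All⇒Any¬ (λ u → All.all? (_∈ᴺ? proj₁ (reachable S u)) S) S ¬conn)
  ...   | u , u∈S , ¬all with reachable S u
  ...     | R , u∈R , closed , _ = inj₂ (R , closed , lose u∈S u∈R , ¬All⇒Any¬ (_∈ᴺ? R) S ¬all)

  -- ToStart c v l: v ∷ l is a walk whose last node has an edge to c.
  data ToStart (c : Node) : Node → List Node → Set where
    last : ∀ {v} → c ∈ succs v → ToStart c v []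
    step : ∀ {v w l} → w ∈ succs v → ToStart c w l → ToStart c v (w ∷ l)

  prepend : ∀ {S c u v l} → u ∈ S → Star (EdgeIn S) u v → ToStart c v l → v ∷ l ⊆ S →
            Σ (List Node) λ l' → ToStart c u l' × v ∷ l ⊆ u ∷ l' × u ∷ l' ⊆ S
  prepend u∈S ε w l⊆S = _ , w , id , l⊆S
  prepend u∈S ((e , v∈S) ◅ p) w l⊆S with prepend v∈S p w l⊆S
  ... | l' , w' , inc , l'⊆S = _ , step e w' , there ∘ inc , λ { (here refl) → u∈S ; (there i) → l'⊆S i }

  -- `Star` allows the empty path, so a single node without a loop counts as strongly connected.
  -- Supplying the first edge separately guarantees a genuine closed walk.
  return : ∀ {S c u v} → u ∈ S → v ∈ succs u → v ∈ S → Star (EdgeIn S) v c → Σ (List Node) λ l → ToStart c u l × u ∷ l ⊆ S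
  return u∈S e v∈S ε = [] , last e , λ { (here refl) → u∈S }
  return u∈S e v∈S ((e' , w∈S) ◅ p) with return v∈S e' w∈S p
  ... | l , w , l⊆S = _ , step e w , λ { (here refl) → u∈S ; (there i) → l⊆S i }

  -- For each further `v` a detour from `c` to `v` and back is put in front of the tour of the
  -- remaining nodes.
  tour : ∀ {S c w} → StronglyConnected S → c ∈ S → w ∈ succs c → w ∈ S → ∀ L → L ⊆ S →
         Σ (List Node) λ l → ToStart c c l × L ⊆ c ∷ l × c ∷ l ⊆ S
  tour conn c∈S e w∈S [] L⊆S with return c∈S e w∈S (conn w∈S c∈S)
  ... | l , w , l⊆S = l , w , (λ ()) , l⊆S
  tour conn c∈S e w∈S (v ∷ L) L⊆S with tour conn c∈S e w∈S L (L⊆S ∘ there)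
  ... | l , w , L⊆l , l⊆S with prepend (L⊆S (here refl)) (conn (L⊆S (here refl)) c∈S) w l⊆S
  ...   | l' , w' , l⊆l' , l'⊆S with prepend c∈S (conn c∈S (L⊆S (here refl))) w' l'⊆S
  ...     | l'' , w'' , l'⊆l'' , l''⊆S =
    l'' , w'' , (λ { (here refl) → l'⊆l'' (here refl) ; (there i) → l'⊆l'' (l⊆l' (L⊆l i)) }) , l''⊆S

  -- A state is the current node and the rest of the current round.
  module Repeat {S c cl} (walk : ToStart c c cl) (inS : c ∷ cl ⊆ S) where

    next : Node × List Node → Node × List Node
    next (v , [])    = c , cl
    next (v , w ∷ l) = w , l

    state : ℕ → Node × List Node
    state zero    = c , cl
    state (suc n) = next (state n)

    branch : ℕ → Node
    branch n = proj₁ (state n)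

    Inv : Node × List Node → Set
    Inv (v , l) = ToStart c v l × v ∷ l ⊆ S

    inv-next : ∀ s → Inv s → Inv (next s)
    inv-next (v , [])    _              = walk , inS
    inv-next (v , w ∷ l) (step e t , i) = t , i ∘ there

    inv : ∀ n → Inv (state n)
    inv zero    = walk , inS
    inv (suc n) = inv-next (state n) (inv n)

    edge-next : ∀ s → Inv s → proj₁ (next s) ∈ succs (proj₁ s)
    edge-next (v , [])    (last e , _)   = e
    edge-next (v , w ∷ l) (step e t , _) = e

    branch-edge : ∀ n → branch (suc n) ∈ succs (branch n)
    branch-edge n = edge-next (state n) (inv n)

    restart : ∀ l {v} n → state n ≡ (v , l) → Σ ℕ λ k → n ≤ k × state k ≡ (c , cl)
    restart []      n e = suc n , n≤1+n n , cong next e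
    restart (w ∷ l) n e with restart l (suc n) (cong next e)
    ... | k , n<k , e' = k , ≤-trans (n≤1+n n) n<k , e'

    passes : ∀ l {v s} n → state n ≡ (v , l) → s ∈ v ∷ l → Σ ℕ λ k → n ≤ k × branch k ≡ s
    passes l n e (here refl) = n , ≤-refl , cong proj₁ e
    passes (w ∷ l) n e (there i) with passes l (suc n) (cong next e) i
    ... | k , n<k , e' = k , ≤-trans (n≤1+n n) n<k , e'

    -- After time `m` the current round runs out, and the next full round passes every node of the
    -- walk.
    recurs : ∀ {s} → s ∈ c ∷ cl → ∀ m → Σ ℕ λ k → m ≤ k × branch k ≡ s
    recurs i m with restart (proj₂ (state m)) m refl
    ... | k , m≤k , e with passes cl k e i
    ...   | k' , k≤k' , e' = k' , ≤-trans m≤k k≤k' , e'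

  -- What the trace condition says of a branch whose nodes are exactly those of S, each visited infinitely often.
  Decreasing : List Node → ℕ → Set
  Decreasing S x = All (λ v → FreeS x (seq v)) S × Any (λ v → caseVar v ≡ just x) S

  -- The trace condition gives a variable only up to double negation, which decidability removes.
  -- The search is finite because only case variables of nodes in `S` can qualify.
  decreasing? : ∀ S → Dec (Σ ℕ (Decreasing S))
  decreasing? S = map′ to from (Any.any? (λ v → candidate? (caseVar v)) S)
    where
    Candidate : Maybe ℕ → Set
    Candidate m = Σ ℕ λ x → m ≡ just x × All (λ v → FreeS x (seq v)) S
    candidate? : ∀ m → Dec (Candidate m)
    candidate? nothing  = no λ { (_ , () , _) }
    candidate? (just x) = map′ (λ a → x , refl , a) (λ { (_ , refl , a) → a }) (All.all? (λ v → freeS? x (seq v)) S)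
    to : Any (Candidate ∘ caseVar) S → Σ ℕ (Decreasing S)
    to h with find h
    ... | v , v∈S , x , e , free = x , free , lose v∈S e
    from : Σ ℕ (Decreasing S) → Any (Candidate ∘ caseVar) S
    from (x , free , h) = Any.map (λ e → x , e , free) h

  -- A tour of `S` repeated forever meets each node again after any time `N`, so a variable free
  -- from `N` on is free in all of `S`. The branch never leaves `S`, so a `Case` on it is a `Case`
  -- in `S`.
  decreasing-variable : ∀ {S c w} → StronglyConnected S → Valid c → c ∈ S → w ∈ succs c → w ∈ S → Σ ℕ (Decreasing S)
  decreasing-variable {S} conn valid c∈S e w∈S with decreasing? S
  ... | yes d = d
  ... | no ¬d with tour conn c∈S e w∈S S id
  ...   | l , walk , S⊆l , l⊆S = ⊥-elim (trace branch valid branch-edge λ { (x , (N , free) , inf) →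
      ¬d (x , All.tabulate (λ v∈S → case recurs (S⊆l v∈S) N of λ { (n , N≤n , refl) → free n N≤n })
            , (case inf 0 of λ { (n , _ , e) → lose (proj₂ (inv n) (here refl)) e })) })
    where open Repeat walk l⊆S

  -- From cyclic to inductive proofs

  Exits : List Node → List Fml → Set
  Exits S C = ∀ {v w} → v ∈ S → w ∈ succs v → w ∉ S → C ⊢ seq w

  -- The variables in X keep their value along S, so context formulas may mention them.
  Steady : List ℕ → Node → Set
  Steady X v = ∀ {x} → x ∈ X → FreeS x (seq v) × caseVar v ≢ just x

  OverVars : List ℕ → List Fml → Set
  OverVars X C = ∀ {x} → Any (FreeF x) C → x ∈ X

  -- Variables of `C` lie in `X`. They are therefore free in `seq v`, so that no eigenvariable
  -- clashes with `C`, and differ from the case variable, so that the `Case` substitutions leave `C`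
  -- unchanged.
  local : ∀ {X C v} → OverVars X C → Valid v → Steady X v → (∀ {w} → w ∈ succs v → C ⊢ seq w) → C ⊢ seq v
  local {X} {C} {v} over valid steady ds =
    apply (λ h → proj₁ (steady (over h))) (λ h → proj₂ (steady (over h)))
      (local-rule valid) (map⁺ (All.tabulate ds))
    where
    apply : ∀ {m s ps} → (∀ {x} → Any (FreeF x) C → FreeS x s) → (∀ {x} → Any (FreeF x) C → m ≢ just x) →
            GRule m s ps → All (C ⊢_) ps → C ⊢ s
    apply free _     (base r) ds           = rule-under C (λ y y∉s y∈C → y∉s (free y∈C)) r ds
    apply _    _     link     (d ∷ [])     = d
    apply {s = s} _ cases (case x) (d ∷ e ∷ []) = case-under C x s (fix-C d) (fix-C e)
      where
      fix-C : ∀ {t} → C ⊢ subS x t s → map (fsubF x t) C ⊢ subS x t s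
      fix-C {t} = subst (_⊢ subS x t s) (sym (map-fsubF-fresh x t C (λ h → cases h refl)))

  -- The recursion is on a bound for the size of `S`. `X` and `C` vary because each component
  -- treated adds its induction variable and its induction hypothesis.
  Derivable : ℕ → Set
  Derivable n = ∀ {S X C} → length S ≤ n → All Valid S → All (Steady X) S → OverVars X C → Exits S C →
                ∀ {v} → v ∈ S → C ⊢ seq v

  module Component {n} (derive : Derivable n) {S X C} (S≤n : length S ≤ suc n)
    (valid : All Valid S) (steady : All (Steady X) S) (over : OverVars X C) (exits : Exits S C)
    {x} (free : All (λ v → FreeS x (seq v)) S) (has-case : Any (λ v → caseVar v ≡ just x) S) where

    X' = x ∷ X
    -- The induction formula. Variables outside `X'` may be eigenvariables or be changed by `Case`
    -- along `S`, hence the closure; `x` stays free as the induction variable.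
    P  = conj (map (closeExcept X' ∘ seqF ∘ seq) S)
    D  = atPred x P

    P-over : ∀ {y} → FreeF y P → y ∈ X'
    P-over h with find (free-conj (map _ S) h)
    ... | φ , i , h' with ∈-map⁻ (closeExcept X' ∘ seqF ∘ seq) i
    ...   | v , _ , refl = free-closeExcept X' (seqF (seq v)) h'

    over' : OverVars X' (D ∷ C)
    over' (here h) with free-atPred x P h
    ... | inj₁ e  = here e
    ... | inj₂ h' = P-over h'
    over' (there h) = there (over h)

    P⇒seq : ∀ {Γ v} → v ∈ S → PA⊢ (Γ ⇒ [ P ]) → Γ ⊢ seq v
    P⇒seq {v = v} v∈S d = seqFE (seq v) (closeE _ (conjE (∈-map⁺ (closeExcept X' ∘ seqF ∘ seq) v∈S) d))

    -- A variable of `C` belongs to `X`, and steadiness excludes a `Case` on it, whereas `S`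
    -- contains one on `x`.
    x∉C : ¬ Any (FreeF x) C
    x∉C h with find has-case
    ... | v , v∈S , e = proj₂ (All.lookup steady v∈S (over h)) e

    -- The only place where the induction hypothesis `D` is used. The zero premise must be an exit;
    -- a successor premise that stays in `S` is one of the sequents covered by `P`.
    case-node : ∀ {v} → v ∈ S → caseVar v ≡ just x → D ∷ C ⊢ seq v
    case-node {v} v∈S e = apply e (local-rule (All.lookup valid v∈S)) (map⁺ (All.tabulate premise))
      where
      Premise : Sequent → Set
      Premise s = C ⊢ s ⊎ Σ Node λ w → w ∈ S × s ≡ seq w
      premise : ∀ {w} → w ∈ succs v → Premise (seq w)
      premise {w} e with w ∈ᴺ? S
      ... | yes w∈S = inj₂ (w , w∈S , refl)
      ... | no w∉S  = inj₁ (exits v∈S e w∉S)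
      apply : ∀ {m s ps} → m ≡ just x → GRule m s ps → All Premise ps → D ∷ C ⊢ s
      apply {s = s} refl (case x) (p₀ ∷ pₛ ∷ []) = case-under (D ∷ C) x s (fix-C (zero-premise p₀)) (fix-C (succ-premise pₛ))
        where
        t₀ = `0
        tₛ = `S (fv x)
        fix-C : ∀ {t} → fsubF x t D ∷ C ⊢ subS x t s → map (fsubF x t) (D ∷ C) ⊢ subS x t s
        fix-C {t} = subst (λ C' → fsubF x t D ∷ C' ⊢ subS x t s) (sym (map-fsubF-fresh x t C x∉C))
        zero-premise : Premise (subS x t₀ s) → fsubF x t₀ D ∷ C ⊢ subS x t₀ s
        zero-premise (inj₁ d) = ⊢-mono (subS x t₀ s) there d
        zero-premise (inj₂ (w , w∈S , e)) = ⊥-elim (subS-0-fresh x s (subst (FreeS x) (sym e) (All.lookup free w∈S)))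
        succ-premise : Premise (subS x tₛ s) → fsubF x tₛ D ∷ C ⊢ subS x tₛ s
        succ-premise (inj₁ d) = ⊢-mono (subS x tₛ s) there d
        succ-premise (inj₂ (w , w∈S , e)) =
          -- After substituting `S x` for `x`, the predecessor spoken of in `D` is `x` itself, so
          -- `D` yields `P`.
          subst (fsubF x tₛ D ∷ C ⊢_) (sym e) (P⇒seq w∈S (atPred-S-E x P (hyp (here refl))))

    other? = λ v → ¬? (Maybe.≡-dec _≟_ (caseVar v) (just x))
    S' = filter other? S

    S'⊆S : S' ⊆ S
    S'⊆S = proj₁ ∘ ∈-filter⁻ other?

    -- Removing the `Case` nodes on `x` creates new exits, namely these nodes, and `case-node`
    -- derives them.
    exits' : Exits S' (D ∷ C)
    exits' {v} {w} v∈S' e w∉S' with w ∈ᴺ? S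
    ... | no w∉S = ⊢-mono (seq w) there (exits (S'⊆S v∈S') e w∉S)
    ... | yes w∈S with Maybe.≡-dec _≟_ (caseVar w) (just x)
    ...   | yes c = case-node w∈S c
    ...   | no ¬c = ⊥-elim (w∉S' (∈-filter⁺ other? w∈S ¬c))

    -- Once no `Case` on `x` remains, `x` itself keeps its value along `S'`, so `D` is an admissible
    -- context formula there.
    steady' : ∀ {v} → v ∈ S' → Steady X' v
    steady' v∈S' (here refl) = All.lookup free (S'⊆S v∈S') , proj₂ (∈-filter⁻ other? {xs = S} v∈S')
    steady' v∈S' (there i)   = All.lookup steady (S'⊆S v∈S') i

    derive' : ∀ {v} → v ∈ S → D ∷ C ⊢ seq v
    derive' {v} v∈S with Maybe.≡-dec _≟_ (caseVar v) (just x)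
    ... | yes c = case-node v∈S c
    ... | no ¬c = derive (s≤s⁻¹ (≤-trans (filter-notAll other? S (Any.map (λ e h → h e) has-case)) S≤n))
      (All.tabulate (All.lookup valid ∘ S'⊆S)) (All.tabulate steady') over' exits' (∈-filter⁺ other? v∈S ¬c)

    -- Each sequent is derived from `D ∷ C`, whose variables lie in `X'`; that permits its closure
    -- outside `X'` and so the whole conjunction.
    P-derivable : PA⊢ (C ⇒ [ P ])
    P-derivable = pred-induction x P x∉C (conjI (map _ S) λ i → closure (∈-map⁻ (closeExcept X' ∘ seqF ∘ seq) i))
      where
      closure : ∀ {φ} → Σ Node (λ v → v ∈ S × φ ≡ closeExcept X' (seqF (seq v))) → PA⊢ (D ∷ C ⇒ [ φ ])
      closure (v , v∈S , refl) = closeExceptI X' (seqF (seq v)) over' (seqFI (seq v) (derive' v∈S))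

  derivable : ∀ n → Derivable n
  derivable zero {S = _ ∷ _} ()
  derivable (suc n) {S = S@(_ ∷ _)} {X} {C} S≤n valid steady over exits {v} v∈S with connected-or-split S
  -- Since `R` is closed within `S`, an edge leaving `S₁` leaves `S`, so `S₁` can be derived first.
  -- An edge leaving `S₂` then ends in `S₁` or outside `S`.
  ... | inj₂ (R , closed , some∈R , some∉R) = in-S
    where
    in? = _∈ᴺ? R
    out? = ¬? ∘ in?
    S₁ = filter in? S
    S₂ = filter out? S
    S₁⊆S : S₁ ⊆ S
    S₁⊆S = proj₁ ∘ ∈-filter⁻ in?
    S₂⊆S : S₂ ⊆ S
    S₂⊆S = proj₁ ∘ ∈-filter⁻ out?
    in-S₁ : ∀ {v} → v ∈ S₁ → C ⊢ seq v
    in-S₁ = derivable n (s≤s⁻¹ (≤-trans (filter-notAll in? S some∉R) S≤n))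
      (All.tabulate (All.lookup valid ∘ S₁⊆S)) (All.tabulate (All.lookup steady ∘ S₁⊆S)) over
      λ v∈S₁ e w∉S₁ → exits (S₁⊆S v∈S₁) e λ w∈S →
        w∉S₁ (∈-filter⁺ in? w∈S (closed (proj₂ (∈-filter⁻ in? {xs = S} v∈S₁)) e w∈S))
    exits₂ : Exits S₂ C
    exits₂ {w = w} v∈S₂ e w∉S₂ with w ∈ᴺ? S
    ... | no w∉S = exits (S₂⊆S v∈S₂) e w∉S
    ... | yes w∈S with in? w
    ...   | yes w∈R = in-S₁ (∈-filter⁺ in? w∈S w∈R)
    ...   | no w∉R  = ⊥-elim (w∉S₂ (∈-filter⁺ out? w∈S w∉R))
    in-S : C ⊢ seq v
    in-S with in? v
    ... | yes v∈R = in-S₁ (∈-filter⁺ in? v∈S v∈R)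
    ... | no v∉R = derivable n (s≤s⁻¹ (≤-trans (filter-notAll out? S (Any.map (λ h k → k h) some∈R)) S≤n))
      (All.tabulate (All.lookup valid ∘ S₂⊆S)) (All.tabulate (All.lookup steady ∘ S₂⊆S)) over exits₂
      (∈-filter⁺ out? v∈S v∉R)
  ... | inj₁ conn with Any.any? (_∈ᴺ? S) (succs v)
  -- Here `v` lies on no cycle inside `S`: all its premises are exits and its own rule suffices.
  ...   | no none = local over (All.lookup valid v∈S) (All.lookup steady v∈S)
          λ e → exits v∈S e λ w∈S → none (lose e w∈S)
  ...   | yes some with find some
  ...     | w , e , w∈S with decreasing-variable conn (All.lookup valid v∈S) v∈S e w∈S
  ...       | x , free , has-case = P⇒seq v∈S P-derivable
    where open Component (derivable n) S≤n valid steady over exits free has-case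

-- The graph of a proof tree

mutual
  at-++ : ∀ {u} t p q → at t p ≡ just u → at t (p ++ q) ≡ at u q
  at-++ t []                      q refl = refl
  at-++ (inner _ _ _ ts) (i ∷ p)  q e    = atL-++ ts i p q e

  atL-++ : ∀ {u} ts i p q → atL ts i p ≡ just u → atL ts i (p ++ q) ≡ at u q
  atL-++ (t ∷ ts) zero    p q e = at-++ t p q e
  atL-++ (t ∷ ts) (suc i) p q e = atL-++ ts i p q e

atL-split : ∀ {u} ts i q → atL ts i q ≡ just u →
            i < length ts × Σ PT λ t → atL ts i [] ≡ just t × at t q ≡ just u
atL-split (t ∷ ts) zero    q e = s≤s z≤n , t , refl , e
atL-split (t ∷ ts) (suc i) q e with atL-split ts i q e
... | i< , r = s≤s i< , r

atL-< : ∀ ts {i} → i < length ts → Σ PT λ t → atL ts i [] ≡ just t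
atL-< (t ∷ ts) {zero}  _  = t , refl
atL-< (t ∷ ts) {suc i} i< = atL-< ts (s≤s⁻¹ i<)

mutual
  wf-at : ∀ {R t u} p → WF R t → at t p ≡ just u → WF R u
  wf-at []      wf             refl = wf
  wf-at (i ∷ p) (inner _ wfs) e    = wf-atL i p wfs e

  wf-atL : ∀ {R ts u} i p → All (WF R) ts → atL ts i p ≡ just u → WF R u
  wf-atL zero    p (wf ∷ wfs) e = wf-at p wf e
  wf-atL (suc i) p (wf ∷ wfs) e = wf-atL i p wfs e

-- The value at `[]` is a default that is never met, because `pathsL` lists only nonempty paths.
sucHead : Path → Path
sucHead []      = []
sucHead (i ∷ p) = suc i ∷ p

mutual
  paths : PT → List Path
  paths (inner _ _ _ ts) = [] ∷ pathsL ts
  paths (bud _ _)        = [ [] ]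

  pathsL : List PT → List Path
  pathsL []       = []
  pathsL (t ∷ ts) = map (0 ∷_) (paths t) ++ map sucHead (pathsL ts)

mutual
  ∈-paths : ∀ {u} t p → at t p ≡ just u → p ∈ paths t
  ∈-paths (inner _ _ _ ts) []      e = here refl
  ∈-paths (bud _ _)        []      e = here refl
  ∈-paths (inner _ _ _ ts) (i ∷ p) e = there (∈-pathsL ts i p e)

  ∈-pathsL : ∀ {u} ts i p → atL ts i p ≡ just u → i ∷ p ∈ pathsL ts
  ∈-pathsL (t ∷ ts) zero    p e = ∈-++⁺ˡ (∈-map⁺ (0 ∷_) (∈-paths t p e))
  ∈-pathsL (t ∷ ts) (suc i) p e = ∈-++⁺ʳ (map (0 ∷_) (paths t)) (∈-map⁺ sucHead (∈-pathsL ts i p e))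

module _ (T : PT) where

  TracesFrom : Path → Set
  TracesFrom p = ∀ b → b 0 ≡ p → (∀ n → Step T (b n) (b (suc n))) → ¬ ¬ (Σ ℕ λ x → Progressing T b x)

  -- A branch from `q` is prolonged by `p` in front; a trace on the longer branch is one on the
  -- shorter after an index shift.
  traces-step : ∀ {p q} → TracesFrom p → Step T p q → TracesFrom q
  traces-step {p} traces st b refl steps ¬progress = traces b' refl steps' (¬progress ∘ shorten)
    where
    b' : ℕ → Path
    b' zero    = p
    b' (suc n) = b n
    steps' : ∀ n → Step T (b' n) (b' (suc n))
    steps' zero    = st
    steps' (suc n) = steps n
    shorten : Σ ℕ (Progressing T b') → Σ ℕ (Progressing T b)
    shorten (x , N , free , inf) = x , N , (λ n N≤n → free (suc n) (m≤n⇒m≤1+n N≤n)) , inf'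
      where
      inf' : ∀ m → Σ ℕ λ n → m ≤ n × CaseAt T x (b n)
      -- Asking for a position from `suc m` on excludes the added first node.
      inf' m with inf (suc m)
      ... | suc n , m<n , c = n , s≤s⁻¹ m<n , c

  traces-path : ∀ {t u} p q → TracesFrom p → at T p ≡ just t → at t q ≡ just u → TracesFrom (p ++ q)
  traces-path p [] traces e e' = subst TracesFrom (sym (++-identityʳ p)) traces
  traces-path {t = inner _ _ _ ts} p (i ∷ q) traces e e' with atL-split ts i q e'
  ... | i< , t' , e₁ , e₂ =
    subst TracesFrom (∷ʳ-++ p i q)
      (traces-path (p ∷ʳ i) q (traces-step traces (child i e i<)) (trans (at-++ T p [ i ] e) e₁) e₂)

  -- All paths serve as graph nodes, which gives decidable equality at once. A path outside the tree
  -- receives a dummy sequent, and validity keeps it out of the argument.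
  seqM : Maybe PT → Sequent
  seqM (just t) = seqOf t
  seqM nothing  = [] ⇒ []

  caseM : Maybe PT → Maybe ℕ
  caseM (just (inner _ _ (case x) _)) = just x
  caseM _                             = nothing

  succsM : Path → Maybe PT → List Path
  succsM p (just (inner _ _ _ ts)) = applyUpTo (p ∷ʳ_) (length ts)
  succsM p (just (bud _ q))        = [ q ]
  succsM p nothing                 = []

  -- An arbitrary `f` in place of `p ∷ʳ_` lets the recursion shift the child index.
  seqs-children : ∀ (f : ℕ → Path) {ts ps} → (∀ i → at T (f i) ≡ atL ts i []) →
                  Pointwise (λ t p → seqOf t ≡ p) ts ps → map (seqM ∘ at T) (applyUpTo f (length ts)) ≡ ps
  seqs-children f h []       = refl
  seqs-children f h (e ∷ es) = cong₂ _∷_ (trans (cong seqM (h 0)) e) (seqs-children (f ∘ suc) (h ∘ suc) es)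

  succ-step : ∀ {p q} m → at T p ≡ m → q ∈ succsM p m → Step T p q
  succ-step {p} (just (inner _ _ _ ts)) e q∈ with ∈-applyUpTo⁻ (p ∷ʳ_) q∈
  ... | i , i< , refl = child i e i<
  succ-step (just (bud _ q)) e (here refl) = link e

  ValidPath : Path → Set
  ValidPath p = Σ PT λ t → at T p ≡ just t

  valid? : ∀ p → Dec (ValidPath p)
  valid? p with at T p
  ... | just t  = yes (t , refl)
  ... | nothing = no λ ()

  step-valid : WF T T → ∀ {p q} → Step T p q → ValidPath q
  step-valid wf {p} (child {ts = ts} i e i<) with atL-< ts i<
  ... | t , e' = t , trans (at-++ T p [ i ] e) e'
  step-valid wf {p} (link e) with wf-at p wf e
  ... | bud e' _ = _ , e'

  rule-at : WF T T → ∀ {p} t → at T p ≡ just t →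
            GRule (caseM (just t)) (seqOf t) (map (seqM ∘ at T) (succsM p (just t)))
  rule-at wf {p} t e with wf-at p wf e
  rule-at wf {p} (bud s q) e | bud e' refl rewrite e' = link
  rule-at wf {p} (inner s ps r ts) e | inner labels _
    rewrite seqs-children (p ∷ʳ_) (λ i → at-++ T p [ i ] e) labels with r
  ... | base r' = base r'
  ... | case x  = case x

  graph : CPAProof T → ProofGraph
  graph (wf , gtc) = record
    { Node        = Path
    ; _≟ᴺ_       = List.≡-dec _≟_
    ; seq        = seqM ∘ at T
    ; succs      = λ p → succsM p (at T p)
    ; caseVar    = caseM ∘ at T
    ; Valid      = ValidPath
    ; local-rule = λ {p} → local-rule p
    ; trace      = λ b (t , e) steps ¬trace →
        -- The global trace condition concerns branches from the root; it is carried along the tree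
        -- path to the arbitrary valid start `b 0`.
        traces-path [] (b 0) (λ b b0 st → gtc b (b0 , st)) refl e b refl (λ n → succ-step (at T (b n)) refl (steps n))
          λ { (x , N , free , inf) → ¬trace (x , (N , λ n N≤n → freeAt (b n) (free n N≤n)) , λ m → caseAt b m (inf m)) }
    }
    where
    local-rule : ∀ p → ValidPath p →
                 GRule (caseM (at T p)) (seqM (at T p)) (map (seqM ∘ at T) (succsM p (at T p)))
    local-rule p (t , e) = subst (λ m → GRule (caseM m) (seqM m) (map (seqM ∘ at T) (succsM p m))) (sym e) (rule-at wf t e)
    freeAt : ∀ {x} p → FreeAt T x p → FreeS x (seqM (at T p))
    freeAt {x} p (t , e , h) = subst (FreeS x ∘ seqM) (sym e) h
    caseAt : ∀ {x} b m → (Σ ℕ λ n → m ≤ n × CaseAt T x (b n)) → Σ ℕ λ n → m ≤ n × caseM (at T (b n)) ≡ just x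
    caseAt b m (n , m≤n , _ , _ , _ , _ , e , isCase) = n , m≤n , cong caseM e

theorem6p2 : (Γ Δ : List Fml) → CPA⊢ (Γ ⇒ Δ) → PA⊢ (Γ ⇒ Δ)
theorem6p2 Γ Δ (T , refl , proof@(wf , _)) =
  subst (λ Γ → PA⊢ (Γ ⇒ Δ)) (++-identityʳ Γ)
    -- At the outset no variable is kept fixed and the context is empty, so steadiness is vacuous.
    (derivable (length nodes) {X = []} {C = []} ≤-refl (All.tabulate (proj₂ ∘ ∈-filter⁻ (valid? T) {xs = paths T}))
      (All.tabulate λ _ ()) (λ ())
      -- Successors of tree nodes, including companions of buds, are tree nodes, so the full set of
      -- nodes has no exits.
      (λ {p} _ q∈ q∉ → ⊥-elim (q∉ (node (step-valid T wf (succ-step T (at T p) refl q∈)))))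
      {v = []} (node (T , refl)))
  where
  open Unfolding (graph T proof)
  nodes = filter (valid? T) (paths T)
  node : ∀ {p} → ValidPath T p → p ∈ nodes
  node {p} h@(t , e) = ∈-filter⁺ (valid? T) (∈-paths T p e) h
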